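{- The type $V = \sum_{X:\mathcal U^{\leq 0}}\mathrm{inV}(X)$ with decoding $\mathrm{El}_V : V\to\mathcal U^{\leq 0}$ given by the first projection is univalent for propositions: for $v_0,v_1:V$ such that $\mathrm{El}_V(v_0)$ and $\mathrm{El}_V(v_1)$ are propositions, the canonical map $(v_0 = v_1)\to(\mathrm{El}_V(v_0)\simeq\mathrm{El}_V(v_1))$ is an equivalence.
   Context: Homotopy type theory with function extensionality and higher inductive families. $\mathcal U^{\leq 0}$ is a univalent universe of sets ($0$-truncated types), closed under dependent products. $M$ is a set and $N : M\to\mathcal U^{\leq 0}$. The family $\mathrm{inV}$ over $\mathcal U^{\leq 0}$ is the higher inductive family with constructors: (i) for $m:M$, $w_N(m):\mathrm{inV}(N(m))$; (ii) for $A:\mathcal U^{\leq 0}$, $B:A\to\mathcal U^{\leq 0}$, $w_A:\mathrm{inV}(A)$ and $w_B : \prod_{a:A}\mathrm{inV}(B(a))$, $w_\Pi(w_A,w_B):\mathrm{inV}(\prod_{a:A}B(a))$; (iii) for a proposition $X:\mathcal U^{\leq 0}$ and $w_0,w_1:\mathrm{inV}(X)$, a path $\mathrm{ua}(w_0,w_1):w_0=w_1$. -}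

{-# OPTIONS --without-K #-}
module Defs where

open import Level using (Level; _⊔_; suc; zero)
open import Data.Product using (Σ; _,_; proj₁; proj₂)
open import Relation.Binary.PropositionalEquality using (_≡_; refl; subst; cong)

private variable
  a b ℓ : Level

isContr : Set a → Set a
isContr A = Σ A λ c → (x : A) → c ≡ x

isProp : Set a → Set a
isProp A = (x y : A) → x ≡ y

isSet : Set a → Set a
isSet A = (x y : A) → isProp (x ≡ y)

fiber : {A : Set a} {B : Set b} → (A → B) → B → Set (a ⊔ b)
fiber {A = A} f y = Σ A λ x → f x ≡ y

isEquiv : {A : Set a} {B : Set b} → (A → B) → Set (a ⊔ b)
isEquiv {B = B} f = (y : B) → isContr (fiber f y)

_≃_ : Set a → Set b → Set (a ⊔ b)
A ≃ B = Σ (A → B) isEquiv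

idIsEquiv : (A : Set a) → isEquiv (λ (x : A) → x)
idIsEquiv A y = (y , refl) , λ { (x , refl) → refl }

idEquiv : (A : Set a) → A ≃ A
idEquiv A = (λ x → x) , idIsEquiv A

idtoeqv : {A B : Set a} → A ≡ B → A ≃ B
idtoeqv {A = A} refl = idEquiv A

happly : {A : Set a} {B : A → Set b} {f g : (x : A) → B x} →
         f ≡ g → (x : A) → f x ≡ g x
happly refl x = refl

FunExt : (a b : Level) → Set (suc (a ⊔ b))
FunExt a b = {A : Set a} {B : A → Set b} {f g : (x : A) → B x} →
             isEquiv (happly {f = f} {g = g})

Univalence : (a : Level) → Set (suc a)
Univalence a = {A B : Set a} → isEquiv (idtoeqv {A = A} {B = B})

apd : {A : Set a} {P : A → Set b} (f : (x : A) → P x) {x y : A}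
      (p : x ≡ y) → subst P p (f x) ≡ f y
apd f refl = refl

-- The universe U^{≤0} of sets: Σ (X : Set) isSet X, decoded by proj₁.
-- It is univalent given Univalence 0ℓ and FunExt (isSet is a proposition).

U≤0 : Set₁
U≤0 = Σ Set isSet

El : U≤0 → Set
El = proj₁

Π-isSet : FunExt zero zero → (A : Set) (B : A → Set) →
          ((x : A) → isSet (B x)) → isSet ((x : A) → B x)
Π-isSet fe A B hB f g p q =
  p                                   ≡⟨ sym (retr p) ⟩
  inv (happly p)                      ≡⟨ cong inv (funext' (λ x → hB x (f x) (g x) (happly p x) (happly q x))) ⟩
  inv (happly q)                      ≡⟨ retr q ⟩
  q ∎
  where
  open import Relation.Binary.PropositionalEquality using (sym; trans)
  open Relation.Binary.PropositionalEquality.≡-Reasoning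
  inv : ((x : A) → f x ≡ g x) → f ≡ g
  inv h = proj₁ (proj₁ (fe h))
  retr : (p : f ≡ g) → inv (happly p) ≡ p
  retr p = cong proj₁ (proj₂ (fe (happly p)) (p , refl))
  funext' : {h k : (x : A) → f x ≡ g x} → ((x : A) → h x ≡ k x) → h ≡ k
  funext' e = proj₁ (proj₁ (fe e))

ΠU : FunExt zero zero → (A : U≤0) → (El A → U≤0) → U≤0
ΠU fe A B = ((a : El A) → El (B a)) , Π-isSet fe (El A) (λ a → El (B a)) (λ a → proj₂ (B a))

-- The higher inductive family inV over U≤0, given by its constructors
-- and its dependent induction principle (with computation rules).

record IsInV (fe : FunExt zero zero) (M : Set) (N : M → U≤0)
             (inV : U≤0 → Set₁) : Set₂ where
  field
    wN   : (m : M) → inV (N m)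
    wΠ   : (A : U≤0) (B : El A → U≤0) →
           inV A → ((a : El A) → inV (B a)) → inV (ΠU fe A B)
    uaP  : (X : U≤0) → isProp (El X) → (w₀ w₁ : inV X) → w₀ ≡ w₁
    elim : (P : (X : U≤0) → inV X → Set₁)
           (pN : (m : M) → P (N m) (wN m))
           (pΠ : (A : U≤0) (B : El A → U≤0) (wA : inV A)
                 (wB : (a : El A) → inV (B a)) →
                 P A wA → ((a : El A) → P (B a) (wB a)) →
                 P (ΠU fe A B) (wΠ A B wA wB))
           (pua : (X : U≤0) (h : isProp (El X)) (w₀ w₁ : inV X)
                  (p₀ : P X w₀) (p₁ : P X w₁) →
                  subst (P X) (uaP X h w₀ w₁) p₀ ≡ p₁) →
           (X : U≤0) (w : inV X) → P X w
    elim-βN : ∀ P pN pΠ pua (m : M) →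
              elim P pN pΠ pua (N m) (wN m) ≡ pN m
    elim-βΠ : ∀ P pN pΠ pua (A : U≤0) (B : El A → U≤0) (wA : inV A)
                (wB : (a : El A) → inV (B a)) →
              elim P pN pΠ pua (ΠU fe A B) (wΠ A B wA wB)
                ≡ pΠ A B wA wB (elim P pN pΠ pua A wA)
                               (λ a → elim P pN pΠ pua (B a) (wB a))
    elim-βua : ∀ P pN pΠ pua (X : U≤0) (h : isProp (El X)) (w₀ w₁ : inV X) →
               apd (elim P pN pΠ pua X) (uaP X h w₀ w₁)
                 ≡ pua X h w₀ w₁ (elim P pN pΠ pua X w₀) (elim P pN pΠ pua X w₁)

V : (inV : U≤0 → Set₁) → Set₁
V inV = Σ U≤0 inV

ElV : {inV : U≤0 → Set₁} → V inV → Set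
ElV v = El (proj₁ v)

pathToEquivV : {inV : U≤0 → Set₁} (v₀ v₁ : V inV) → v₀ ≡ v₁ → ElV v₀ ≃ ElV v₁
pathToEquivV v₀ .v₀ refl = idEquiv (ElV v₀)

{-# OPTIONS --without-K #-}
-- Both sides of  pathToEquivV v₀ v₁ : (v₀ ≡ v₁) → (ElV v₀ ≃ ElV v₁)  are
-- propositions as soon as ElV v₀ and ElV v₁ are, and a map between
-- propositions that has a map back is an equivalence.
module Submission where

open import Defs
open import Level using (Level; zero)
open import Data.Product using (Σ; _,_; proj₁; proj₂)
open import Data.Product.Properties using (Σ-≡,≡→≡; Σ-≡,≡←≡; Σ-≡,≡↔≡)
open import Function.Bundles using (Inverse)
open import Relation.Binary.PropositionalEquality using (_≡_; refl; cong; sym; trans)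
open import Axiom.UniquenessOfIdentityProofs using (module Constant⇒UIP)

private variable a b : Level

-- Hedberg's argument: any proposition is a set, since h x y is a
-- constant endofunction on x ≡ y.
prop→set : {A : Set a} → isProp A → isSet A
prop→set h x y = Constant⇒UIP.≡-irrelevant (λ {x} {y} _ → h x y) (λ _ _ → refl)

Σ-isProp : {A : Set a} {B : A → Set b} →
           isProp A → ((x : A) → isProp (B x)) → isProp (Σ A B)
Σ-isProp hA hB (x , u) (y , v) with hA x y
... | refl = cong (x ,_) (hB x u v)

retract-isProp : {A : Set a} {B : Set b} (f : A → B) (g : B → A) →
                 ((x : A) → g (f x) ≡ x) → isProp B → isProp A
retract-isProp f g gf hB x y = trans (sym (gf x)) (trans (cong g (hB (f x) (f y))) (gf y))

Σ-path-isProp : {A : Set a} {B : A → Set b} {x y : A} {u : B x} {v : B y} →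
                isProp (x ≡ y) → isProp (B y) → isProp ((x , u) ≡ (y , v))
Σ-path-isProp {B = B} hxy hB =
  retract-isProp Σ-≡,≡←≡ Σ-≡,≡→≡ (Inverse.strictlyInverseˡ Σ-≡,≡↔≡)
    (Σ-isProp hxy (λ p → prop→set hB _ _))

fiber-isProp : {A : Set a} {B : Set b} (f : A → B) →
               isProp A → isProp B → (y : B) → isProp (fiber f y)
fiber-isProp f hA hB y = Σ-isProp hA (λ x → prop→set hB (f x) y)

prop-biimplication→isEquiv : {A : Set a} {B : Set b} (f : A → B) (g : B → A) →
                             isProp A → isProp B → isEquiv f
prop-biimplication→isEquiv f g hA hB y =
  (g y , hB _ _) , fiber-isProp f hA hB y _

module WithFunExt (fe : FunExt zero zero) where

  funext : {A : Set} {B : A → Set} {f g : (x : A) → B x} →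
           ((x : A) → f x ≡ g x) → f ≡ g
  funext h = proj₁ (proj₁ (fe h))

  Π-isProp : {A : Set} {B : A → Set} →
             ((x : A) → isProp (B x)) → isProp ((x : A) → B x)
  Π-isProp hB f g = funext λ x → hB x (f x) (g x)

  isProp-isProp : {A : Set} → isProp (isProp A)
  isProp-isProp h k = Π-isProp (λ x → Π-isProp λ y → prop→set h x y) h k

  isSet-isProp : (A : Set) → isProp (isSet A)
  isSet-isProp A = Π-isProp λ x → Π-isProp λ y → isProp-isProp

  isContr-isProp : {P : Set} → isProp P → isProp (isContr P)
  isContr-isProp hP = Σ-isProp hP λ c → Π-isProp λ x → prop→set hP c x

  ≃-isProp : {A B : Set} → isProp A → isProp B → isProp (A ≃ B)
  ≃-isProp hA hB = Σ-isProp (Π-isProp λ _ → hB) λ f →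
    Π-isProp λ y → isContr-isProp (fiber-isProp f hA hB y)

  module WithUnivalence (univ : Univalence zero) {A B : Set} where

    ua : A ≃ B → A ≡ B
    ua e = proj₁ (proj₁ (univ e))

    ua-idtoeqv : (p : A ≡ B) → ua (idtoeqv p) ≡ p
    ua-idtoeqv p = cong proj₁ (proj₂ (univ (idtoeqv p)) (p , refl))

    ≡-isProp : isProp A → isProp B → isProp (A ≡ B)
    ≡-isProp hA hB = retract-isProp idtoeqv ua ua-idtoeqv (≃-isProp hA hB)

lemma2p5 : (fe : FunExt zero zero) → Univalence zero →
    (M : Set) → isSet M → (N : M → U≤0) →
    (inV : U≤0 → Set₁) → IsInV fe M N inV →
    (v₀ v₁ : V inV) → isProp (ElV v₀) → isProp (ElV v₁) →
    isEquiv (pathToEquivV v₀ v₁)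
lemma2p5 fe univ M _ N inV I v₀@((A₀ , _) , _) v₁@((A₁ , s₁) , _) h₀ h₁ =
  prop-biimplication→isEquiv (pathToEquivV v₀ v₁) equivToPath
    path-isProp (≃-isProp h₀ h₁)
  where
  open WithFunExt fe
  open WithUnivalence univ
  inV₁-isProp : isProp (inV (A₁ , s₁))
  inV₁-isProp = IsInV.uaP I (A₁ , s₁) h₁

  -- a path in V is a path in U≤0 (a type path plus an isSet path) and a
  -- path in inV over it; all three components live in propositions
  path-isProp : isProp (v₀ ≡ v₁)
  path-isProp = Σ-path-isProp (Σ-path-isProp (≡-isProp h₀ h₁) (isSet-isProp A₁)) inV₁-isProp

  equivToPath : A₀ ≃ A₁ → v₀ ≡ v₁
  equivToPath e = Σ-≡,≡→≡ (Σ-≡,≡→≡ (ua e , isSet-isProp A₁ _ _) , inV₁-isProp _ _)
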